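{- The function $(1^n\,0\,1^k)\mapsto E(n,k)$ is in $\#\mathsf{L}$. In particular, computing the Euler numbers $E_n=E(n,n)$, that is, the function $(1^n)\mapsto E_n$, is in $\#\mathsf{L}$.
   Context: The Euler number $E_n=\#\{w\in S_n : w_1>w_2<w_3>\cdots\}$ counts zigzag (alternating) permutations. The Entringer number is $E(n,k)=\#\{w\in S_{n+1} : k+1=w_1>w_2<w_3>\cdots\}$; in particular $E(1,1)=1$, $E(1,0)=0$, and $E(n,0)=0$ for $n>1$. The alphabet is $\Sigma=\{0,1\}$; $1^a$ is the string of $a$ ones and juxtaposition is concatenation. A function given only on strings of a displayed form is extended by $0$ to all other strings. $\#\mathsf{L}$ is the class of functions $f:\Sigma^*\to\mathbb{N}_0$ such that $f(x)$ is the number of accepting computation paths on input $x$ of a fixed nondeterministic Turing machine with read-only input tape that uses $O(\log|x|)$ work space and halts on every computation path. Equivalently: there are a polynomial $q$ and a deterministic $O(\log|x|)$-space Turing machine $M$ with an additional read-once, left-to-right witness tape such that $f(x)=\#\{w\in\Sigma^{q(|x|)}\mid M(x,w)=\mathsf{yes}\}$. -}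

module Defs where

open import Data.Bool.Base using (Bool; true; false; T)
open import Data.Fin.Base as Fin using (Fin; toℕ)
import Data.Fin.Properties as Fin
open import Data.List.Base as List
  using (List; []; _∷_; _++_; [_]; length; filter; allFin; cartesianProductWith; replicate)
open import Data.List.Membership.Propositional using (_∈_)
open import Data.List.Relation.Unary.Unique.Propositional using () renaming (Unique to UniqueL)
open import Data.Nat.Base using (ℕ; zero; suc; _+_; _*_; _≤_)
open import Data.Nat.Logarithm using (⌊log₂_⌋)
import Data.Nat.Properties as ℕ
open import Data.Product.Base using (Σ; ∃; _×_; _,_; proj₁; proj₂)
open import Data.Unit.Base using (⊤; tt)
open import Data.Vec.Base as Vec using (Vec; []; _∷_; head)
open import Data.Vec.Relation.Unary.AllPairs using (allPairs?)
open import Data.Vec.Relation.Unary.Unique.Propositional using (Unique)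
open import Function.Base using (flip)
open import Function.Bundles using (_↔_)
open import Induction.WellFounded using (Acc)
open import Relation.Binary.Construct.Closure.ReflexiveTransitive using (Star)
open import Relation.Binary.PropositionalEquality using (_≡_; refl)
open import Relation.Nullary.Decidable using (Dec; yes; no; map′; ¬?; _×-dec_)
open import Relation.Unary using (Decidable)

private variable
  A : Set
  m n : ℕ

------------------------------------------------------------------------
-- Euler and Entringer numbers

allWords : ∀ m n → List (Vec (Fin m) n)
allWords m zero    = [] ∷ []
allWords m (suc n) = cartesianProductWith _∷_ (allFin m) (allWords m n)

-- Permutations in one-line notation, on the letters 0,…,n-1 instead of
-- 1,…,n.  A word of length n over n letters is a permutation iff its
-- letters are pairwise distinct.
permutations : ∀ n → List (Vec (Fin n) n)
permutations n = filter (allPairs? λ x y → ¬? (x Fin.≟ y)) (allWords n n)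

-- w₁ > w₂ < w₃ > ⋯  and  w₁ < w₂ > w₃ < ⋯
DownUp UpDown : Vec (Fin m) n → Set
DownUp []          = ⊤
DownUp (x ∷ [])    = ⊤
DownUp (x ∷ y ∷ w) = x Fin.> y × UpDown (y ∷ w)
UpDown []          = ⊤
UpDown (x ∷ [])    = ⊤
UpDown (x ∷ y ∷ w) = x Fin.< y × DownUp (y ∷ w)

downUp? : Decidable (DownUp {m} {n})
upDown? : Decidable (UpDown {m} {n})
downUp? []          = yes tt
downUp? (x ∷ [])    = yes tt
downUp? (x ∷ y ∷ w) = (y Fin.<? x) ×-dec upDown? (y ∷ w)
upDown? []          = yes tt
upDown? (x ∷ [])    = yes tt
upDown? (x ∷ y ∷ w) = (x Fin.<? y) ×-dec downUp? (y ∷ w)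

euler : ℕ → ℕ
euler n = length (filter downUp? (permutations n))

-- The condition w₁ = k+1 reads w₁ = k because letters start at 0.
entringer : ℕ → ℕ → ℕ
entringer n k =
  length (filter (λ w → (toℕ (head w) ℕ.≟ k) ×-dec downUp? w) (permutations (suc n)))

------------------------------------------------------------------------
-- Functions on strings, extended by zero

-- true is the letter 1, false is the letter 0.
Word : Set
Word = List Bool

extendByZero : (enc : A → Word) → (∀ x → Dec (∃ λ a → x ≡ enc a)) → (A → ℕ) → Word → ℕ
extendByZero enc dec g x with dec x
... | yes (a , _) = g a
... | no  _       = 0

1^_ : ℕ → Word
1^ n = replicate n true

1^_01^_ : ℕ → ℕ → Word
1^ n 01^ k = (1^ n) ++ false ∷ (1^ k)

unary? : ∀ x → Dec (∃ λ n → x ≡ 1^ n)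
unary? []          = yes (0 , refl)
unary? (false ∷ x) = no λ where (zero , ()) ; (suc _ , ())
unary? (true ∷ x)  = map′ (λ where (n , refl) → suc n , refl)
                          (λ where (suc n , refl) → n , refl)
                          (unary? x)

unaryPair? : ∀ x → Dec (∃ λ (p : ℕ × ℕ) → x ≡ 1^ proj₁ p 01^ proj₂ p)
unaryPair? []          = no λ where ((zero , _) , ()) ; ((suc _ , _) , ())
unaryPair? (false ∷ x) = map′ (λ where (k , refl) → (0 , k) , refl)
                              (λ where ((zero , k) , refl) → k , refl)
                              (unary? x)
unaryPair? (true ∷ x)  = map′ (λ where ((n , k) , refl) → (suc n , k) , refl)
                              (λ where ((suc n , k) , refl) → (n , k) , refl)
                              (unaryPair? x)

entringerFunction : Word → ℕ
entringerFunction =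
  extendByZero (λ (n , k) → 1^ n 01^ k) unaryPair? (λ (n , k) → entringer n k)

eulerFunction : Word → ℕ
eulerFunction = extendByZero 1^_ unary? euler

------------------------------------------------------------------------
-- Nondeterministic Turing machines with a read-only input tape

data Move : Set where
  left stay right : Move

-- The part of a tape to the left of the head is listed from the head
-- outwards.
record Tape (A : Set) : Set where
  constructor tape
  field
    before  : List A
    scanned : A
    after   : List A

open Tape public

write : A → Tape A → Tape A
write a t = record t { scanned = a }

-- The head cannot leave a tape of fixed extent.
moveBounded : Move → Tape A → Tape A
moveBounded left  (tape (b ∷ bs) a as) = tape bs b (a ∷ as)
moveBounded left  (tape []       a as) = tape [] a as
moveBounded stay  t                    = t
moveBounded right (tape bs a (c ∷ as)) = tape (a ∷ bs) c as
moveBounded right (tape bs a [])       = tape bs a []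

-- On a two-way infinite tape, only the cells visited so far are stored;
-- a fresh cell holds the blank.
moveInfinite : A → Move → Tape A → Tape A
moveInfinite ␣ left  (tape (b ∷ bs) a as) = tape bs b (a ∷ as)
moveInfinite ␣ left  (tape []       a as) = tape [] ␣ (a ∷ as)
moveInfinite ␣ stay  t                    = t
moveInfinite ␣ right (tape bs a (c ∷ as)) = tape (a ∷ bs) c as
moveInfinite ␣ right (tape bs a [])       = tape (a ∷ bs) ␣ []

visitedCells : Tape A → ℕ
visitedCells (tape bs _ as) = length bs + suc (length as)

data InputSymbol : Set where
  leftEnd rightEnd : InputSymbol
  letter           : Bool → InputSymbol

IsFinite : Set → Set
IsFinite A = ∃ λ n → A ↔ Fin n

record Action (State Symbol : Set) (tapes : ℕ) : Set where
  constructor action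
  field
    nextState : State
    inputMove : Move
    workMoves : Vec (Symbol × Move) tapes   -- symbol written, then move

-- The lists δ q a s represent finite sets, hence have no repetitions.
record NTM : Set₁ where
  field
    State         : Set
    state-finite  : IsFinite State
    Symbol        : Set
    symbol-finite : IsFinite Symbol
    blank         : Symbol
    tapes         : ℕ
    start         : State
    accepting     : State → Bool
    δ             : State → InputSymbol → Vec Symbol tapes → List (Action State Symbol tapes)
    δ-unique      : ∀ q a s → UniqueL (δ q a s)

module _ (M : NTM) where
  open NTM M

  record Config : Set where
    constructor config
    field
      state : State
      input : Tape InputSymbol
      work  : Vec (Tape Symbol) tapes

  open Config

  initial : Word → Config
  initial x = config start
                     (tape [] leftEnd (List.map letter x ++ [ rightEnd ]))
                     (Vec.replicate tapes (tape [] blank []))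

  transitions : Config → List (Action State Symbol tapes)
  transitions c = δ (state c) (scanned (input c)) (Vec.map scanned (work c))

  apply : Action State Symbol tapes → Config → Config
  apply (action q i ws) c =
    config q (moveBounded i (input c))
             (Vec.zipWith (λ (s , d) t → moveInfinite blank d (write s t)) ws (work c))

  data _⟶_ (c : Config) : Config → Set where
    step : ∀ {t} → t ∈ transitions c → c ⟶ apply t c

  -- The computation paths from c that end in a halting configuration
  -- with accepting state; a path is a sequence of chosen transitions.
  data AcceptingPath (c : Config) : Set where
    halt : transitions c ≡ [] → T (accepting (state c)) → AcceptingPath c
    step : ∀ {t} → t ∈ transitions c → AcceptingPath (apply t c) → AcceptingPath c

  -- Accessibility for the reversed step relation: no computation path
  -- from the initial configuration is infinite.
  HaltsOnEveryPath : Set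
  HaltsOnEveryPath = ∀ x → Acc (flip _⟶_) (initial x)

  space : Config → ℕ
  space c = Vec.sum (Vec.map visitedCells (work c))

  UsesLogSpace : Set
  UsesLogSpace = ∃ λ C → ∃ λ N → ∀ x → N ≤ length x →
    ∀ c → Star _⟶_ (initial x) c → space c ≤ C * ⌊log₂ length x ⌋

  Counts : (Word → ℕ) → Set
  Counts f = ∀ x → AcceptingPath (initial x) ↔ Fin (f x)

_∈#L : (Word → ℕ) → Set₁
f ∈#L = Σ NTM λ M → UsesLogSpace M × HaltsOnEveryPath M × Counts M f

{-# OPTIONS --safe #-}
module Submission where

-- The Entringer numbers satisfy the boustrophedon recurrence
--
--   E(0,0) = 1,  E(n+1,0) = 0,  E(n+1,k+1) = E(n+1,k) + E(n,n-k)  for k <= n.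
--
-- With letters starting at 0, deleting the first letter k of a down-up
-- permutation and closing the gap in the alphabet leaves an up-down
-- permutation with first letter less than k (`entringer-delete`).  For k + 1
-- instead of k, the first letter is less than k or equal to k; in the second
-- case, complementing all letters gives a down-up permutation with first
-- letter n - k (`entringer-suc`).  Deletion and complementation also give
-- E_n = E(n,n) (`euler≡entringer`).
--
-- Write (a,b) for (k,n-k).  The recurrence leads from (a+1,b) to (a,b+1) and
-- to (b,a), so that no subtraction is needed: E(n,k) is the number of
-- accepting paths of a nondeterministic program with two counters that starts
-- with (k,n-k) when k <= n, branches in this way while the first counter is
-- positive, and finally accepts if both counters are zero (`main-run`).
-- Exchanging the counters takes place in the finite control.  The sum of the
-- counters never exceeds the length of the input.  Inputs with k > n are
-- rejected while they are read, and E(n,k) = 0 for them.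
--
-- Any program with counters bounded in this way is carried out by a Turing
-- machine in logarithmic space, with each counter written in binary on its own
-- work tape (`simulate`).  An operation on a counter is a sweep over its low
-- digits and back.  The result is a finite computation tree annotated with its
-- number of accepting leaves and a space bound (`Tree`), from which the count
-- of the accepting paths, the termination and the space bound of the machine
-- are read off (`tree⇒paths`, `tree⇒acc`, `tree⇒space`).

open import Defs
open import Data.Bool.Base using (Bool; true; false; T; if_then_else_)
open import Data.Bool.Properties using (T-≡; T-irrelevant)
open import Data.Fin.Base as Fin using (Fin; toℕ; fromℕ<; punchIn; punchOut; opposite)
open import Data.Fin.Patterns
import Data.Fin.Properties as Fin
open import Data.List.Base as List
  using (List; []; _∷_; _++_; [_]; length; filter; _ʳ++_)
open import Data.List.Membership.Propositional using (_∈_)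
open import Data.List.Membership.Propositional.Properties
  using (∈-filter⁺; ∈-filter⁻; ∈-cartesianProductWith⁺; ∈-allFin; ∈-map⁺; ∈-map⁻; Any↔)
open import Data.List.Membership.Propositional.Properties.WithK using (unique∧set⇒bag)
open import Data.List.Properties using (length-map; filter-none)
open import Data.List.Relation.Binary.BagAndSetEquality using (∼bag⇒↭)
open import Data.List.Relation.Binary.Permutation.Propositional.Properties using (↭-length)
open import Data.List.Relation.Unary.All as ListAll using ([]; _∷_)
open import Data.List.Relation.Unary.AllPairs using ([]; _∷_)
open import Data.List.Relation.Unary.Any using (Any; here; there)
open import Data.List.Relation.Unary.Any.Properties using (∷↔)
open import Data.List.Relation.Unary.Unique.Propositional using () renaming (Unique to UniqueL)
import Data.List.Relation.Unary.Unique.Propositional.Properties as UniqueL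
open import Data.Maybe.Base using (Maybe; just; nothing)
open import Data.Nat.Base
  using (ℕ; zero; suc; pred; _+_; _*_; _∸_; _^_; _≤_; _<_; z≤n; s≤s)
open import Data.Nat.Logarithm using (⌊log₂_⌋; ⌊log₂⌋-mono-≤; ⌊log₂[2^n]⌋≡n)
import Data.Nat.Properties as ℕ
open import Data.Product.Base using (∃; _×_; _,_; proj₁; proj₂)
open import Data.Product.Function.NonDependent.Propositional using (_×-↔_)
open import Data.Sum.Base using (_⊎_; inj₁; inj₂)
open import Data.Sum.Function.Propositional using (_⊎-↔_)
open import Data.Unit.Base using (tt)
open import Data.Vec.Base as Vec using (Vec; []; _∷_; head; lookup; _[_]≔_)
open import Data.Vec.Properties
  using (∷-injective; map-∘; map-cong; map-id; map-replicate; map-[]≔;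
         lookup-map; lookup∘update; []≔-lookup)
open import Data.Vec.Relation.Binary.Pointwise.Inductive as Pointwise
  using (Pointwise; []; _∷_)
open import Data.Vec.Relation.Unary.All as VecAll using (All; []; _∷_)
import Data.Vec.Relation.Unary.All.Properties as VecAll
open import Data.Vec.Relation.Unary.AllPairs using ([]; _∷_; allPairs?)
open import Data.Vec.Relation.Unary.Unique.Propositional using (Unique)
import Data.Vec.Relation.Unary.Unique.Propositional.Properties as Unique
open import Function.Base using (_∘_; case_of_; flip; id)
open import Function.Bundles using (_↔_; mk↔ₛ′; mk⇔; Equivalence)
open import Function.Properties.Inverse using (↔-refl; ↔-sym; ↔-trans)
open import Induction.WellFounded using (Acc; acc)
open import Relation.Binary.Construct.Closure.ReflexiveTransitive using (Star; ε; _◅_)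
open import Relation.Binary.PropositionalEquality
  using (_≡_; _≢_; refl; sym; trans; cong; cong₂; subst; module ≡-Reasoning)
open import Relation.Binary.PropositionalEquality.WithK using (≡-irrelevant)
open import Relation.Nullary using (¬_; yes; no; contradiction)
open import Relation.Nullary.Decidable using (Dec; _×-dec_; ¬?)
open import Relation.Unary using (Decidable)

private variable
  A     : Set
  m n k : ℕ

-- Counting permutations

-- The number of permutations of size n with the property P.
#perms : (n : ℕ) {P : Vec (Fin n) n → Set} → Decidable P → ℕ
#perms n P? = length (filter P? (permutations n))

∈-allWords : (w : Vec (Fin m) n) → w ∈ allWords m n
∈-allWords []      = here refl
∈-allWords (x ∷ w) = ∈-cartesianProductWith⁺ _∷_ (∈-allFin x) (∈-allWords w)

allWords-unique : ∀ m n → UniqueL (allWords m n)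
allWords-unique m zero    = [] ∷ []
allWords-unique m (suc n) =
  UniqueL.cartesianProductWith⁺ _∷_ ∷-injective (UniqueL.allFin⁺ m) (allWords-unique m n)

module _ {n} {P : Vec (Fin n) n → Set} (P? : Decidable P) where

  private
    distinct? : Decidable (Unique {A = Fin n} {n = n})
    distinct? = allPairs? λ x y → ¬? (x Fin.≟ y)

  ∈-perms⁺ : ∀ {w} → Unique w → P w → w ∈ filter P? (permutations n)
  ∈-perms⁺ u p = ∈-filter⁺ P? (∈-filter⁺ distinct? (∈-allWords _) u) p

  ∈-perms⁻ : ∀ {w} → w ∈ filter P? (permutations n) → Unique w × P w
  ∈-perms⁻ w∈ = let w∈′ , p = ∈-filter⁻ P? {xs = permutations n} w∈ in
    proj₂ (∈-filter⁻ distinct? {xs = allWords n n} w∈′) , p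

  perms-unique : UniqueL (filter P? (permutations n))
  perms-unique = UniqueL.filter⁺ P? (UniqueL.filter⁺ distinct? (allWords-unique n n))

  #perms-none : (∀ w → ¬ P w) → #perms n P? ≡ 0
  #perms-none none = cong length (filter-none P? (ListAll.universal none (permutations n)))

-- f maps the permutations with P bijectively onto those with Q.
#perms-bijection :
  {P : Vec (Fin m) m → Set} {Q : Vec (Fin n) n → Set}
  (P? : Decidable P) (Q? : Decidable Q) (f : Vec (Fin m) m → Vec (Fin n) n) →
  (∀ {v w} → f v ≡ f w → v ≡ w) →
  (∀ {v} → Unique v → P v → Unique (f v) × Q (f v)) →
  (∀ {w} → Unique w → Q w → ∃ λ v → f v ≡ w × Unique v × P v) →
  #perms m P? ≡ #perms n Q?
#perms-bijection {m} {n} P? Q? f inj to from = begin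
  length ps              ≡⟨ length-map f ps ⟨
  length (List.map f ps) ≡⟨ ↭-length (∼bag⇒↭ (unique∧set⇒bag
                              (UniqueL.map⁺ inj (perms-unique P?)) (perms-unique Q?)
                              (mk⇔ forth back))) ⟩
  length qs              ∎
  where
  open ≡-Reasoning
  ps = filter P? (permutations m)
  qs = filter Q? (permutations n)

  forth : ∀ {w} → w ∈ List.map f ps → w ∈ qs
  forth w∈ with v , v∈ , refl ← ∈-map⁻ f w∈ =
    let u , p = ∈-perms⁻ P? v∈ ; u′ , q = to u p in ∈-perms⁺ Q? u′ q

  back : ∀ {w} → w ∈ qs → w ∈ List.map f ps
  back w∈ with u , q ← ∈-perms⁻ Q? w∈ with v , refl , u′ , p ← from u q =
    ∈-map⁺ f (∈-perms⁺ P? u′ p)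

length-filter-⊎ : {P Q R : A → Set} (P? : Decidable P) (Q? : Decidable Q) (R? : Decidable R) →
  (∀ {x} → P x → Q x ⊎ R x) → (∀ {x} → Q x → P x) → (∀ {x} → R x → P x) →
  (∀ {x} → Q x → ¬ R x) → ∀ xs →
  length (filter P? xs) ≡ length (filter Q? xs) + length (filter R? xs)
length-filter-⊎ P? Q? R? split Q⊆P R⊆P disj []       = refl
length-filter-⊎ P? Q? R? split Q⊆P R⊆P disj (x ∷ xs)
  with IH ← length-filter-⊎ P? Q? R? split Q⊆P R⊆P disj xs | P? x | Q? x | R? x
... | _     | yes q | yes r = contradiction r (disj q)
... | yes _ | yes _ | no  _ = cong suc IH
... | yes _ | no  _ | yes _ = trans (cong suc IH) (sym (ℕ.+-suc _ _))
... | yes p | no ¬q | no ¬r with split p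
...   | inj₁ q = contradiction q ¬q
...   | inj₂ r = contradiction r ¬r
length-filter-⊎ P? Q? R? split Q⊆P R⊆P disj (x ∷ xs)
    | no ¬p | yes q | no  _ = contradiction (Q⊆P q) ¬p
length-filter-⊎ P? Q? R? split Q⊆P R⊆P disj (x ∷ xs)
    | no ¬p | no  _ | yes r = contradiction (R⊆P r) ¬p
length-filter-⊎ P? Q? R? split Q⊆P R⊆P disj (x ∷ xs)
    | no  _ | no  _ | no  _ = IH

-- Zigzag words under maps of letters

module _ {f : Fin m → Fin n} where

  module _ (mono : ∀ {x y} → x Fin.< y → f x Fin.< f y) where
    upDown-map⁺ : (v : Vec (Fin m) k) → UpDown v → UpDown (Vec.map f v)
    downUp-map⁺ : (v : Vec (Fin m) k) → DownUp v → DownUp (Vec.map f v)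
    upDown-map⁺ []          _         = tt
    upDown-map⁺ (_ ∷ [])    _         = tt
    upDown-map⁺ (_ ∷ y ∷ v) (x<y , z) = mono x<y , downUp-map⁺ (y ∷ v) z
    downUp-map⁺ []          _         = tt
    downUp-map⁺ (_ ∷ [])    _         = tt
    downUp-map⁺ (_ ∷ y ∷ v) (x>y , z) = mono x>y , upDown-map⁺ (y ∷ v) z

  module _ (reflects : ∀ {x y} → f x Fin.< f y → x Fin.< y) where
    upDown-map⁻ : (v : Vec (Fin m) k) → UpDown (Vec.map f v) → UpDown v
    downUp-map⁻ : (v : Vec (Fin m) k) → DownUp (Vec.map f v) → DownUp v
    upDown-map⁻ []          _         = tt
    upDown-map⁻ (_ ∷ [])    _         = tt
    upDown-map⁻ (_ ∷ y ∷ v) (x<y , z) = reflects x<y , downUp-map⁻ (y ∷ v) z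
    downUp-map⁻ []          _         = tt
    downUp-map⁻ (_ ∷ [])    _         = tt
    downUp-map⁻ (_ ∷ y ∷ v) (x>y , z) = reflects x>y , upDown-map⁻ (y ∷ v) z

  module _ (anti : ∀ {x y} → x Fin.< y → f y Fin.< f x) where
    upDown-flip : (v : Vec (Fin m) k) → UpDown v → DownUp (Vec.map f v)
    downUp-flip : (v : Vec (Fin m) k) → DownUp v → UpDown (Vec.map f v)
    upDown-flip []          _         = tt
    upDown-flip (_ ∷ [])    _         = tt
    upDown-flip (_ ∷ y ∷ v) (x<y , z) = anti x<y , downUp-flip (y ∷ v) z
    downUp-flip []          _         = tt
    downUp-flip (_ ∷ [])    _         = tt
    downUp-flip (_ ∷ y ∷ v) (x>y , z) = anti x>y , upDown-flip (y ∷ v) z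

-- Complementation of permutations

opposite-anti : {x y : Fin n} → x Fin.< y → opposite y Fin.< opposite x
opposite-anti {n} {x} {y} x<y
  rewrite Fin.opposite-prop x | Fin.opposite-prop y = ℕ.∸-monoʳ-< (s≤s x<y) (Fin.toℕ<n y)

-- Replaces each letter x by n - 1 - x.
complement : Vec (Fin n) k → Vec (Fin n) k
complement = Vec.map opposite

complement-involutive : (v : Vec (Fin n) k) → complement (complement v) ≡ v
complement-involutive v = begin
  complement (complement v)          ≡⟨ map-∘ opposite opposite v ⟨
  Vec.map (opposite ∘ opposite) v    ≡⟨ map-cong Fin.opposite-involutive v ⟩
  Vec.map id v                       ≡⟨ map-id v ⟩
  v                                  ∎
  where open ≡-Reasoning

involution-injective : {f : A → A} → (∀ x → f (f x) ≡ x) → ∀ {x y} → f x ≡ f y → x ≡ y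
involution-injective {f = f} inv {x} {y} eq = trans (sym (inv x)) (trans (cong f eq) (inv y))

#perms-complement :
  {P Q : Vec (Fin n) n → Set} (P? : Decidable P) (Q? : Decidable Q) →
  (∀ {v} → P v → Q (complement v)) → (∀ {v} → Q v → P (complement v)) →
  #perms n P? ≡ #perms n Q?
#perms-complement P? Q? P⇒Q Q⇒P = #perms-bijection P? Q? complement
  (involution-injective complement-involutive)
  (λ u p → complement-unique u , P⇒Q p)
  (λ {w} u q → complement w , complement-involutive w , complement-unique u , Q⇒P q)
  where
  complement-unique : {v : Vec (Fin n) k} → Unique v → Unique (complement v)
  complement-unique = Unique.map⁺ (involution-injective Fin.opposite-involutive)

-- The boustrophedon recurrence

punchIn-mono-< : ∀ i {x y : Fin n} → x Fin.< y → punchIn i x Fin.< punchIn i y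
punchIn-mono-< i x<y = ℕ.≰⇒> (ℕ.<⇒≱ x<y ∘ Fin.punchIn-cancel-≤ i _ _)

punchIn-cancel-< : ∀ i {x y : Fin n} → punchIn i x Fin.< punchIn i y → x Fin.< y
punchIn-cancel-< i lt = ℕ.≰⇒> (ℕ.<⇒≱ lt ∘ Fin.punchIn-mono-≤ i _ _)

punchIn-<ᵢ⁺ : ∀ i {x : Fin n} → toℕ x < toℕ i → punchIn i x Fin.< i
punchIn-<ᵢ⁺ (Fin.suc i) {Fin.zero}  _         = s≤s z≤n
punchIn-<ᵢ⁺ (Fin.suc i) {Fin.suc x} (s≤s x<i) = s≤s (punchIn-<ᵢ⁺ i x<i)

punchIn-<ᵢ⁻ : ∀ i {x : Fin n} → punchIn i x Fin.< i → toℕ x < toℕ i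
punchIn-<ᵢ⁻ (Fin.suc i) {Fin.zero}  _        = s≤s z≤n
punchIn-<ᵢ⁻ (Fin.suc i) {Fin.suc x} (s≤s lt) = s≤s (punchIn-<ᵢ⁻ i lt)

map-injective : {f : Fin m → Fin n} → (∀ {x y} → f x ≡ f y → x ≡ y) →
                ∀ {v w : Vec (Fin m) k} → Vec.map f v ≡ Vec.map f w → v ≡ w
map-injective inj {[]}    {[]}    _  = refl
map-injective inj {_ ∷ _} {_ ∷ _} eq =
  let e , es = ∷-injective eq in cong₂ _∷_ (inj e) (map-injective inj es)

unique-map⁻ : {f : Fin m → Fin n} (v : Vec (Fin m) k) → Unique (Vec.map f v) → Unique v
unique-map⁻ []      []      = []
unique-map⁻ (x ∷ v) (a ∷ u) = VecAll.map (_∘ cong _) (VecAll.map⁻ a) ∷ unique-map⁻ v u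

punchIn-preimage : ∀ {i} {w : Vec (Fin (suc n)) k} → All (i ≢_) w →
                   ∃ λ v → Vec.map (punchIn i) v ≡ w
punchIn-preimage []        = [] , refl
punchIn-preimage (i≢x ∷ a) =
  let v , eq = punchIn-preimage a in
  punchOut i≢x ∷ v , cong₂ _∷_ (Fin.punchIn-punchOut i≢x) eq

-- The property counted by the Entringer numbers.
startsWith? : ∀ k → Decidable (λ (w : Vec (Fin (suc n)) (suc n)) → toℕ (head w) ≡ k × DownUp w)
startsWith? k w = (toℕ (head w) ℕ.≟ k) ×-dec downUp? w

-- The property that is left when the first letter k of a down-up
-- permutation is deleted.
startsBelow? : ∀ k → Decidable (λ (w : Vec (Fin (suc n)) (suc n)) → toℕ (head w) < k × UpDown w)
startsBelow? k w = (toℕ (head w) ℕ.<? k) ×-dec upDown? w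

-- Deleting the first letter k and lowering the letters above k by one is a
-- bijection; it fixes the second letter, which is less than k.
entringer-delete : k ≤ suc n → entringer (suc n) k ≡ #perms (suc n) (startsBelow? k)
entringer-delete {k} {n} k≤1+n = sym (#perms-bijection (startsBelow? k) (startsWith? k) insert
  (map-injective (Fin.punchIn-injective i _ _) ∘ proj₂ ∘ ∷-injective) forth back)
  where
  i : Fin (suc (suc n))
  i = fromℕ< (s≤s k≤1+n)

  i≡k : toℕ i ≡ k
  i≡k = Fin.toℕ-fromℕ< (s≤s k≤1+n)

  insert : Vec (Fin (suc n)) (suc n) → Vec (Fin (suc (suc n))) (suc (suc n))
  insert v = i ∷ Vec.map (punchIn i) v

  forth : ∀ {v} → Unique v → toℕ (head v) < k × UpDown v →
          Unique (insert v) × toℕ (head (insert v)) ≡ k × DownUp (insert v)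
  forth {v@(x ∷ _)} u (x<k , z) =
    VecAll.map⁺ (VecAll.universal (λ y → Fin.punchInᵢ≢i i y ∘ sym) v) ∷
      Unique.map⁺ (Fin.punchIn-injective i _ _) u ,
    i≡k ,
    punchIn-<ᵢ⁺ i (subst (toℕ x <_) (sym i≡k) x<k) , upDown-map⁺ (punchIn-mono-< i) v z

  back : ∀ {w} → Unique w → toℕ (head w) ≡ k × DownUp w →
         ∃ λ v → insert v ≡ w × Unique v × toℕ (head v) < k × UpDown v
  back {j ∷ w} (a ∷ u) (j≡k , z) with refl ← Fin.toℕ-injective (trans j≡k (sym i≡k))
    with v@(x ∷ _) , refl ← punchIn-preimage a =
    v , refl , unique-map⁻ v u , subst (toℕ x <_) i≡k (punchIn-<ᵢ⁻ i (proj₁ z)) ,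
    upDown-map⁻ (punchIn-cancel-< i) v (proj₂ z)

entringer-zero : ∀ n → entringer (suc n) 0 ≡ 0
entringer-zero n = trans (entringer-delete {0} {n} z≤n) (#perms-none (startsBelow? {n} 0) λ _ ())

entringer-out-of-range : n < k → entringer n k ≡ 0
entringer-out-of-range {n} {k} n<k = #perms-none (startsWith? {n} k) λ where
  (x ∷ _) (x≡k , _) → ℕ.<⇒≱ (Fin.toℕ<n x) (subst (n <_) (sym x≡k) n<k)

-- The first letters less than k + 1 are those less than k, and k itself.
entringer-suc : k ≤ n → entringer (suc n) (suc k) ≡ entringer (suc n) k + entringer n (n ∸ k)
entringer-suc {k} {n} k≤n = begin
  entringer (suc n) (suc k)
    ≡⟨ entringer-delete (s≤s k≤n) ⟩
  #perms (suc n) (startsBelow? (suc k))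
    ≡⟨ length-filter-⊎ (startsBelow? (suc k)) (startsBelow? k) startsAt?
         (λ (h≤k , z) → split (ℕ.m≤n⇒m<n∨m≡n (ℕ.≤-pred h≤k)) z)
         (λ (h<k , z) → ℕ.m<n⇒m<1+n h<k , z)
         (λ (h≡k , z) → s≤s (ℕ.≤-reflexive h≡k) , z)
         (λ (h<k , _) (h≡k , _) → ℕ.<-irrefl h≡k h<k)
         (permutations (suc n)) ⟩
  #perms (suc n) (startsBelow? k) + #perms (suc n) startsAt?
    ≡⟨ cong₂ _+_ (sym (entringer-delete (ℕ.m≤n⇒m≤1+n k≤n)))
                 (#perms-complement startsAt? (startsWith? (n ∸ k)) at⇒with with⇒at) ⟩
  entringer (suc n) k + entringer n (n ∸ k) ∎
  where
  open ≡-Reasoning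

  startsAt? : Decidable (λ (w : Vec (Fin (suc n)) (suc n)) → toℕ (head w) ≡ k × UpDown w)
  startsAt? w = (toℕ (head w) ℕ.≟ k) ×-dec upDown? w

  at⇒with : ∀ {w} → toℕ (head w) ≡ k × UpDown w →
            toℕ (head (complement w)) ≡ n ∸ k × DownUp (complement w)
  at⇒with {w@(x ∷ _)} (x≡k , z) =
    trans (Fin.opposite-prop x) (cong (n ∸_) x≡k) , upDown-flip opposite-anti w z

  with⇒at : ∀ {w} → toℕ (head w) ≡ n ∸ k × DownUp w →
            toℕ (head (complement w)) ≡ k × UpDown (complement w)
  with⇒at {w@(x ∷ _)} (x≡n∸k , z) =
    trans (Fin.opposite-prop x) (trans (cong (n ∸_) x≡n∸k) (ℕ.m∸[m∸n]≡n k≤n)) ,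
    downUp-flip opposite-anti w z

  split : ∀ {h} {Z : Set} → h < k ⊎ h ≡ k → Z → (h < k × Z) ⊎ (h ≡ k × Z)
  split (inj₁ h<k) z = inj₁ (h<k , z)
  split (inj₂ h≡k) z = inj₂ (h≡k , z)

-- Every first letter is less than n + 1, so the condition on it is void.
euler≡entringer : ∀ n → euler n ≡ entringer n n
euler≡entringer zero    = refl
euler≡entringer (suc n) = sym (begin
  entringer (suc n) (suc n)
    ≡⟨ entringer-delete {suc n} {n} ℕ.≤-refl ⟩
  #perms (suc n) (startsBelow? (suc n))
    ≡⟨ #perms-complement (startsBelow? (suc n)) downUp?
         (λ {v} (_ , z) → upDown-flip opposite-anti v z)
         (λ {v} z → Fin.toℕ<n (head (complement v)) , downUp-flip opposite-anti v z) ⟩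
  euler (suc n) ∎)
  where open ≡-Reasoning

-- Computation trees of a Turing machine

module _ (M : NTM) where
  open NTM M using (accepting)
  open Config

  -- Tree B c n: the computation tree below c is finite with at most two
  -- choices at each configuration, has n accepting leaves, and needs no
  -- more than B work cells.
  data Tree (B : ℕ) (c : Config M) : ℕ → Set where
    accept : transitions M c ≡ [] → accepting (state c) ≡ true → space M c ≤ B → Tree B c 1
    reject : transitions M c ≡ [] → accepting (state c) ≡ false → space M c ≤ B → Tree B c 0
    step   : ∀ {t n} → transitions M c ≡ [ t ] → space M c ≤ B →
             Tree B (apply M t c) n → Tree B c n
    fork   : ∀ {t u m n} → transitions M c ≡ t ∷ u ∷ [] → space M c ≤ B →
             Tree B (apply M t c) m → Tree B (apply M u c) n → Tree B c (m + n)

module _ {M : NTM} where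
  open NTM M using (accepting)
  open Config

  private variable
    B    : ℕ
    c c′ : Config M

  no-transition : ∀ {t} → transitions M c ≡ [] → ¬ t ∈ transitions M c
  no-transition eq t∈ with () ← subst (_ ∈_) eq t∈

  private
    Successful : Config M → Action _ _ _ → Set
    Successful c t = AcceptingPath M (apply M t c)

  paths-unfold : ∀ c {t ts} → transitions M c ≡ t ∷ ts →
                 AcceptingPath M c ↔ Any (Successful c) (t ∷ ts)
  paths-unfold c eq = subst (λ ts → AcceptingPath M c ↔ Any (Successful c) ts) eq
    (↔-trans (mk↔ₛ′ to (λ (_ , t∈ , p) → step t∈ p) (λ _ → refl) from∘to) Any↔)
    where
    to : AcceptingPath M c → ∃ λ t → t ∈ transitions M c × Successful c t
    to (halt eq′ _) = contradiction (trans (sym eq′) eq) λ ()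
    to (step t∈ p)  = _ , t∈ , p

    from∘to : ∀ p → (let _ , t∈ , q = to p in step t∈ q) ≡ p
    from∘to (halt eq′ _) = contradiction (trans (sym eq′) eq) λ ()
    from∘to (step _ _)   = refl

  Any[-]↔ : {A : Set} {P : A → Set} {x : A} → Any P [ x ] ↔ P x
  Any[-]↔ = mk↔ₛ′ (λ where (here p) → p ; (there ())) here (λ _ → refl)
    (λ where (here _) → refl ; (there ()))

  tree⇒paths : Tree M B c n → AcceptingPath M c ↔ Fin n
  tree⇒paths {c = c} (accept eq yes! _) = mk↔ₛ′
    (λ _ → 0F)
    (λ _ → halt eq accepts)
    (λ where 0F → refl ; (Fin.suc ()))
    (λ where (halt eq′ a) → cong₂ halt (≡-irrelevant eq eq′) (T-irrelevant accepts a)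
             (step t∈ _)  → contradiction t∈ (no-transition {c = c} eq))
    where accepts = Equivalence.from T-≡ yes!
  tree⇒paths {c = c} (reject eq no! _) =
    mk↔ₛ′ none (λ ()) (λ ()) (λ p → contradiction (none p) λ ())
    where
    none : AcceptingPath M c → Fin 0
    none (halt _ a)  with () ← subst T no! a
    none (step t∈ _) = contradiction t∈ (no-transition {c = c} eq)
  tree⇒paths {c = c} (step eq _ t) =
    ↔-trans (paths-unfold c eq) (↔-trans Any[-]↔ (tree⇒paths t))
  tree⇒paths {c = c} (fork eq _ t u) =
    ↔-trans (paths-unfold c eq) (↔-trans (↔-sym (∷↔ (Successful c)))
      (↔-trans (tree⇒paths t ⊎-↔ ↔-trans Any[-]↔ (tree⇒paths u)) (↔-sym Fin.+↔⊎)))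

  tree⇒acc : Tree M B c n → Acc (flip (_⟶_ M)) c
  tree⇒acc {c = c} (accept eq _ _) = acc λ where
    (step t∈) → contradiction t∈ (no-transition {c = c} eq)
  tree⇒acc {c = c} (reject eq _ _) = acc λ where
    (step t∈) → contradiction t∈ (no-transition {c = c} eq)
  tree⇒acc {c = c} (step eq _ t)   = acc λ where
    (step t∈) → case subst (_ ∈_) eq t∈ of λ where (here refl) → tree⇒acc t
  tree⇒acc {c = c} (fork eq _ t u) = acc λ where
    (step t∈) → case subst (_ ∈_) eq t∈ of λ where
      (here refl)         → tree⇒acc t
      (there (here refl)) → tree⇒acc u

  tree⇒space : Tree M B c n → Star (_⟶_ M) c c′ → space M c′ ≤ B
  tree⇒space (accept _ _ s) ε = s
  tree⇒space (reject _ _ s) ε = s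
  tree⇒space (step _ s _)   ε = s
  tree⇒space (fork _ s _ _) ε = s
  tree⇒space {c = c} (accept eq _ _) (step t∈ ◅ _) =
    contradiction t∈ (no-transition {c = c} eq)
  tree⇒space {c = c} (reject eq _ _) (step t∈ ◅ _) =
    contradiction t∈ (no-transition {c = c} eq)
  tree⇒space (step eq _ t)   (step t∈ ◅ r) with subst (_ ∈_) eq t∈
  ... | here refl = tree⇒space t r
  tree⇒space (fork eq _ t u) (step t∈ ◅ r) with subst (_ ∈_) eq t∈
  ... | here refl         = tree⇒space t r
  ... | there (here refl) = tree⇒space u r

-- Nondeterministic counter programs

-- Instructions of a program with d counters.  The labels say where to
-- continue.  `move` moves the input head, `fork` chooses between two labels,
-- and `test` continues at its first label if the counter is zero and at its
-- second label otherwise.  `dec` is meant for positive counters only.  The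
-- labels of `fork` differ because transitions form a set.
data Instruction (Label : Set) (d : ℕ) : Set where
  halt : Instruction Label d
  move : Move → Label → Instruction Label d
  fork : (l₁ l₂ : Label) → l₁ ≢ l₂ → Instruction Label d
  inc  : Fin d → Label → Instruction Label d
  dec  : Fin d → Label → Instruction Label d
  test : Fin d → (zero nonzero : Label) → Instruction Label d

-- The next instruction depends on the label and the scanned input symbol.
-- `accepting` matters only at labels where the program halts.
record Program : Set₁ where
  field
    Label        : Set
    label-finite : IsFinite Label
    counters     : ℕ
    start        : Label
    accepting    : Label → Bool
    instruction  : Label → InputSymbol → Instruction Label counters

module _ (P : Program) where
  open Program P

  -- Run K l inp vs n: started at label l with input tape inp and counter
  -- values vs, the program halts on all paths, accepts on n of them, raises
  -- no counter to 2 ^ K or above, and never decrements zero.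
  data Run (K : ℕ) (l : Label) (inp : Tape InputSymbol) (vs : Vec ℕ counters) : ℕ → Set where
    accept    : instruction l (scanned inp) ≡ halt → accepting l ≡ true → Run K l inp vs 1
    reject    : instruction l (scanned inp) ≡ halt → accepting l ≡ false → Run K l inp vs 0
    move      : ∀ {m l′ n} → instruction l (scanned inp) ≡ move m l′ →
                Run K l′ (moveBounded m inp) vs n → Run K l inp vs n
    fork      : ∀ {l₁ l₂ l₁≢l₂ m n} → instruction l (scanned inp) ≡ fork l₁ l₂ l₁≢l₂ →
                Run K l₁ inp vs m → Run K l₂ inp vs n → Run K l inp vs (m + n)
    inc       : ∀ {i l′ v n} → instruction l (scanned inp) ≡ inc i l′ →
                lookup vs i ≡ v → suc v < 2 ^ K →
                Run K l′ inp (vs [ i ]≔ suc v) n → Run K l inp vs n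
    dec       : ∀ {i l′ v n} → instruction l (scanned inp) ≡ dec i l′ →
                lookup vs i ≡ suc v → Run K l′ inp (vs [ i ]≔ v) n → Run K l inp vs n
    ifZero    : ∀ {i l₀ l₁ n} → instruction l (scanned inp) ≡ test i l₀ l₁ →
                lookup vs i ≡ 0 → Run K l₀ inp vs n → Run K l inp vs n
    ifNonzero : ∀ {i l₀ l₁ v n} → instruction l (scanned inp) ≡ test i l₀ l₁ →
                lookup vs i ≡ suc v → Run K l₁ inp vs n → Run K l inp vs n

-- Binary counters

-- A work cell holds a binary digit or is blank.
Cell : Set
Cell = Maybe Bool

pattern ␣ = nothing
pattern 𝟘 = just false
pattern 𝟙 = just true

-- Least significant digit first; a blank counts as the digit 0.
value : List Cell → ℕ
value []       = 0
value (𝟙 ∷ cs) = suc (2 * value cs)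
value (_ ∷ cs) = 2 * value cs

-- The contents of the cells after adding one; a missing or blank cell
-- receives the carry.
increment : List Cell → List Cell
increment []       = [ 𝟙 ]
increment (𝟙 ∷ cs) = 𝟘 ∷ increment cs
increment (_ ∷ cs) = 𝟙 ∷ cs

-- Subtracting one turns the low zeros into ones; only positive values
-- matter.
decrement : List Cell → List Cell
decrement (𝟙 ∷ cs) = 𝟘 ∷ cs
decrement (𝟘 ∷ cs) = 𝟙 ∷ decrement cs
decrement cs       = cs

-- The zero test reads up to the first 1 or blank.  If it runs off the
-- stored cells, then one more blank is stored.
visit : List Cell → List Cell
visit []       = [ ␣ ]
visit (𝟘 ∷ cs) = 𝟘 ∷ visit cs
visit cs       = cs

isZero : List Cell → Bool
isZero (𝟙 ∷ _)  = false
isZero (𝟘 ∷ cs) = isZero cs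
isZero _        = true

-- At most k digits, then at most one blank, which a zero test may leave.
data Shape : ℕ → List Cell → Set where
  []  : ∀ {k} → Shape k []
  [␣] : ∀ {k} → Shape k [ ␣ ]
  _∷_ : ∀ {k cs} b → Shape k cs → Shape (suc k) (just b ∷ cs)

-- The cells represent the value v with at most k digits.
Stores : ℕ → List Cell → ℕ → Set
Stores k cs v = Shape k cs × value cs ≡ v

private variable
  v  : ℕ
  cs : List Cell

shape⇒length : Shape k cs → length cs ≤ suc k
shape⇒length []      = z≤n
shape⇒length [␣]     = s≤s z≤n
shape⇒length (_ ∷ s) = s≤s (shape⇒length s)

increment-stores : Stores k cs v → suc v < 2 ^ k → Stores k (increment cs) (suc v)
increment-stores {cs = ds} (s , refl) bound = shape s bound , val ds
  where
  val : ∀ cs → value (increment cs) ≡ suc (value cs)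
  val []       = refl
  val (␣ ∷ cs) = refl
  val (𝟘 ∷ cs) = refl
  val (𝟙 ∷ cs) = trans (cong (2 *_) (val cs)) (ℕ.*-suc 2 (value cs))

  shape : Shape k cs → suc (value cs) < 2 ^ k → Shape k (increment cs)
  shape {zero}  []  (s≤s ())
  shape {zero}  [␣] (s≤s ())
  shape {suc k} []  _ = true ∷ []
  shape {suc k} [␣] _ = true ∷ []
  shape (false ∷ s) _ = true ∷ s
  shape {suc k} {_ ∷ cs} (true ∷ s) b = false ∷ shape s
    (ℕ.*-cancelˡ-< 2 _ _ (subst (_< 2 ^ suc k) (sym (ℕ.*-suc 2 (value cs))) b))

decrement-stores : Stores k cs (suc v) → Stores k (decrement cs) v
decrement-stores (s , eq) = shape s , trans (val s (subst (0 <_) (sym eq) (s≤s z≤n))) (cong pred eq)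
  where
  shape : Shape k cs → Shape k (decrement cs)
  shape []          = []
  shape [␣]         = [␣]
  shape (false ∷ s) = true ∷ shape s
  shape (true ∷ s)  = false ∷ s

  double-pred : ∀ n → 0 < n → suc (2 * pred n) ≡ pred (2 * n)
  double-pred (suc n) _ = cong pred (sym (ℕ.*-suc 2 n))

  val : Shape k cs → 0 < value cs → value (decrement cs) ≡ pred (value cs)
  val [] ()
  val [␣] ()
  val {cs = _ ∷ cs} (false ∷ s) pos =
    trans (cong (λ n → suc (2 * n)) (val s pos′)) (double-pred _ pos′)
    where pos′ = ℕ.*-cancelˡ-< 2 0 (value cs) pos
  val (true ∷ s)  pos = refl

visit-stores : Stores k cs v → Stores k (visit cs) v
visit-stores {cs = ds} (s , refl) = shape s , val ds
  where
  shape : Shape k cs → Shape k (visit cs)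
  shape []          = [␣]
  shape [␣]         = [␣]
  shape (false ∷ s) = false ∷ shape s
  shape (true ∷ s)  = true ∷ s

  val : ∀ cs → value (visit cs) ≡ value cs
  val []       = refl
  val (␣ ∷ cs) = refl
  val (𝟘 ∷ cs) = cong (2 *_) (val cs)
  val (𝟙 ∷ cs) = refl

isZero-stores-zero : Stores k cs 0 → isZero cs ≡ true
isZero-stores-zero ([] , _)           = refl
isZero-stores-zero ([␣] , _)          = refl
isZero-stores-zero {cs = _ ∷ cs} (false ∷ s , eq) =
  isZero-stores-zero (s , ℕ.*-cancelˡ-≡ (value cs) 0 2 eq)

isZero-stores-suc : Stores k cs (suc v) → isZero cs ≡ false
isZero-stores-suc (true ∷ _ , _)   = refl
isZero-stores-suc {cs = _ ∷ cs} (false ∷ s , eq) with value cs in eq′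
... | zero  = contradiction eq λ ()
... | suc _ = isZero-stores-suc (s , eq′)

-- Compilation of counter programs to Turing machines

-- `run` executes the instruction at the current label, `sweep` moves right
-- over the low digits of the counter that the instruction acts on, and
-- `rewind i` brings head i back home.
data Phase (d : ℕ) : Set where
  run sweep : Phase d
  rewind    : Fin d → Phase d

phase-finite : ∀ d → Phase d ↔ Fin (2 + d)
phase-finite d = mk↔ₛ′
  (λ where run → 0F ; sweep → 1F ; (rewind i) → Fin.suc (Fin.suc i))
  (λ where 0F → run ; 1F → sweep ; (Fin.suc (Fin.suc i)) → rewind i)
  (λ where 0F → refl ; 1F → refl ; (Fin.suc (Fin.suc i)) → refl)
  (λ where run → refl ; sweep → refl ; (rewind i) → refl)

cell-finite : Cell ↔ Fin 3
cell-finite = mk↔ₛ′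
  (λ where ␣ → 0F ; 𝟘 → 1F ; 𝟙 → 2F)
  (λ where 0F → ␣ ; 1F → 𝟘 ; 2F → 𝟙)
  (λ where 0F → refl ; 1F → refl ; 2F → refl)
  (λ where ␣ → refl ; 𝟘 → refl ; 𝟙 → refl)

-- A counter at rest.  The head scans a cell that stays blank, and the
-- digits lie to its right; this blank is what `rewind` stops at.
home : List Cell → Tape Cell
home = tape [] ␣

-- Counter i lives on work tape i.  Work heads are at home in phase `run`.
-- The input head rests in the other phases, so that the phase `sweep` can
-- look up the current instruction again.
module Compilation (P : Program) where
  open Program P renaming (counters to d)

  State : Set
  State = Phase d × Label

  Actions : Set
  Actions = List (Action State Cell d)

  keep : Cell → Cell × Move
  keep a = a , stay

  -- Leaves the work tapes alone.
  pass : State → Move → Vec Cell d → Action State Cell d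
  pass q m s = action q m (Vec.map keep s)

  -- On work tape i, writes a and moves by m; all else rests.
  touch : Fin d → State → Cell → Move → Vec Cell d → Actions
  touch i q a m s = [ action q stay (Vec.map keep s [ i ]≔ (a , m)) ]

  execute : Label → Instruction Label d → Vec Cell d → Actions
  execute l halt           s = []
  execute l (move m l′)    s = [ pass (run , l′) m s ]
  execute l (fork l₁ l₂ _) s = pass (run , l₁) stay s ∷ pass (run , l₂) stay s ∷ []
  execute l (inc i _)      s = touch i (sweep , l) ␣ right s
  execute l (dec i _)      s = touch i (sweep , l) ␣ right s
  execute l (test i _ _)   s = touch i (sweep , l) ␣ right s

  -- One step of a sweep, by the scanned digit: write and go on to the right,
  -- or write, turn around, and continue at the given label once home.
  -- Borrowing from a blank would mean decrementing zero.
  carry borrow : Label → Fin d → Label → Cell → Vec Cell d → Actions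
  carry l i l′ 𝟙 = touch i (sweep , l) 𝟘 right
  carry l i l′ _ = touch i (rewind i , l′) 𝟙 left
  borrow l i l′ 𝟘 = touch i (sweep , l) 𝟙 right
  borrow l i l′ 𝟙 = touch i (rewind i , l′) 𝟘 left
  borrow l i l′ ␣ = λ _ → []

  scan : Label → Fin d → Label → Label → Cell → Vec Cell d → Actions
  scan l i l₀ l₁ 𝟘 = touch i (sweep , l) 𝟘 right
  scan l i l₀ l₁ 𝟙 = touch i (rewind i , l₁) 𝟙 left
  scan l i l₀ l₁ ␣ = touch i (rewind i , l₀) ␣ left

  -- One step of rewinding.
  return : Fin d → Label → Cell → Vec Cell d → Actions
  return i l ␣        = touch i (run , l) ␣ stay
  return i l (just b) = touch i (rewind i , l) (just b) left

  sweepOver : Label → Instruction Label d → Vec Cell d → Actions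
  sweepOver l (inc i l′)     s = carry l i l′ (lookup s i) s
  sweepOver l (dec i l′)     s = borrow l i l′ (lookup s i) s
  sweepOver l (test i l₀ l₁) s = scan l i l₀ l₁ (lookup s i) s
  sweepOver l _              s = []

  δ : State → InputSymbol → Vec Cell d → Actions
  δ (run , l)      a s = execute l (instruction l a) s
  δ (sweep , l)    a s = sweepOver l (instruction l a) s
  δ (rewind i , l) a s = return i l (lookup s i) s

  carry-unique : ∀ {l i l′} c s → UniqueL (carry l i l′ c s)
  carry-unique ␣ s = [] ∷ []
  carry-unique 𝟘 s = [] ∷ []
  carry-unique 𝟙 s = [] ∷ []

  borrow-unique : ∀ {l i l′} c s → UniqueL (borrow l i l′ c s)
  borrow-unique ␣ s = []
  borrow-unique 𝟘 s = [] ∷ []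
  borrow-unique 𝟙 s = [] ∷ []

  scan-unique : ∀ {l i l₀ l₁} c s → UniqueL (scan l i l₀ l₁ c s)
  scan-unique ␣ s = [] ∷ []
  scan-unique 𝟘 s = [] ∷ []
  scan-unique 𝟙 s = [] ∷ []

  return-unique : ∀ {i l} c s → UniqueL (return i l c s)
  return-unique ␣        s = [] ∷ []
  return-unique (just b) s = [] ∷ []

  δ-unique : ∀ q a s → UniqueL (δ q a s)
  δ-unique (run , l) a s with instruction l a
  ... | halt             = []
  ... | move m l′        = [] ∷ []
  ... | fork l₁ l₂ l₁≢l₂ = ((λ where refl → l₁≢l₂ refl) ∷ []) ∷ [] ∷ []
  ... | inc i _          = [] ∷ []
  ... | dec i _          = [] ∷ []
  ... | test i _ _       = [] ∷ []
  δ-unique (sweep , l) a s with instruction l a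
  ... | halt       = []
  ... | move _ _   = []
  ... | fork _ _ _ = []
  ... | inc i _    = carry-unique (lookup s i) s
  ... | dec i _    = borrow-unique (lookup s i) s
  ... | test i _ _ = scan-unique (lookup s i) s
  δ-unique (rewind i , l) a s = return-unique (lookup s i) s

  machine : NTM
  machine = record
    { State         = State
    ; state-finite  = _ , ↔-trans (phase-finite d ×-↔ proj₂ label-finite) (↔-sym Fin.*↔×)
    ; Symbol        = Cell
    ; symbol-finite = _ , cell-finite
    ; blank         = ␣
    ; tapes         = d
    ; start         = run , start
    ; accepting     = accepting ∘ proj₂
    ; δ             = δ
    ; δ-unique      = δ-unique
    }

  -- The effect of an action on the work tapes.
  act : ∀ {e} → Vec (Cell × Move) e → Vec (Tape Cell) e → Vec (Tape Cell) e
  act = Vec.zipWith (λ (a , m) t → moveInfinite ␣ m (write a t))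

  act-keep : ∀ {e} (ts : Vec (Tape Cell) e) → act (Vec.map keep (Vec.map scanned ts)) ts ≡ ts
  act-keep []       = refl
  act-keep (t ∷ ts) = cong (t ∷_) (act-keep ts)

  act-touch : ∀ {e} (ts : Vec (Tape Cell) e) i {t a m} →
    act (Vec.map keep (Vec.map scanned (ts [ i ]≔ t)) [ i ]≔ (a , m)) (ts [ i ]≔ t)
      ≡ ts [ i ]≔ moveInfinite ␣ m (write a t)
  act-touch (_ ∷ ts) Fin.zero    = cong (_ ∷_) (act-keep ts)
  act-touch (t ∷ ts) (Fin.suc i) = cong (t ∷_) (act-touch ts i)

  Fits : ℕ → Tape Cell → Set
  Fits W t = visitedCells t ≤ W

  fits⇒space : ∀ {e W} {ts : Vec (Tape Cell) e} → All (Fits W) ts →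
               Vec.sum (Vec.map visitedCells ts) ≤ e * W
  fits⇒space []       = z≤n
  fits⇒space (f ∷ fs) = ℕ.+-mono-≤ f (fits⇒space fs)

  All-[]≔ : ∀ {e} {A : Set} {R : A → Set} {xs : Vec A e} {x} →
            All R xs → R x → ∀ i → All R (xs [ i ]≔ x)
  All-[]≔ (_ ∷ rs) r Fin.zero     = r ∷ rs
  All-[]≔ (r′ ∷ rs) r (Fin.suc i) = r′ ∷ All-[]≔ rs r i

  -- The tape after moving right onto the first cell of the second list; L
  -- holds the cells to the left, nearest first.
  arrive : List Cell → List Cell → Tape Cell
  arrive L []       = tape L ␣ []
  arrive L (c ∷ cs) = tape L c cs

  arrive-right : ∀ L a cs → moveInfinite ␣ right (tape L a cs) ≡ arrive (a ∷ L) cs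
  arrive-right L a []      = refl
  arrive-right L a (_ ∷ _) = refl

  arrive-visited : ∀ L cs → visitedCells (arrive L cs) ≤ length L + suc (length cs)
  arrive-visited L []       = ℕ.≤-refl
  arrive-visited L (_ ∷ cs) = ℕ.+-monoʳ-≤ (length L) (ℕ.n≤1+n _)

  -- Work tape i is at some intermediate stage, and the other tapes are those
  -- of ts.
  module Sweep {W : ℕ} (inp : Tape InputSymbol) {ts : Vec (Tape Cell) d}
               (fits : All (Fits W) ts) (i : Fin d) where

    on : State → Tape Cell → ℕ → Set
    on q t = Tree machine (d * W) (config q inp (ts [ i ]≔ t))

    -- `rule` gives the actions in state q as a function of the cell scanned
    -- on tape i.
    touch-step : ∀ {q q′ a m t n} (rule : Cell → Vec Cell d → Actions) →
      (∀ s → δ q (scanned inp) s ≡ rule (lookup s i) s) →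
      rule (scanned t) ≡ touch i q′ a m → Fits W t →
      on q′ (moveInfinite ␣ m (write a t)) n → on q t n
    touch-step {t = t} rule δ≡ rule≡ fit next = step
      (trans (δ≡ s) (trans (cong (λ c → rule c s) scans) (cong (λ r → r s) rule≡)))
      (fits⇒space (All-[]≔ fits fit i))
      (subst (λ us → Tree machine (d * W) (config _ inp us) _) (sym (act-touch ts i)) next)
      where
      s = Vec.map scanned (ts [ i ]≔ t)
      scans : lookup s i ≡ scanned t
      scans = trans (lookup-map i scanned (ts [ i ]≔ t)) (cong scanned (lookup∘update i ts t))

    -- The cells to the left of the head after passing the digits bs, the last
    -- one passed first.
    prefix : List Bool → List Cell
    prefix bs = List.map just bs ++ [ ␣ ]

    advance : ∀ {q n} L a cs → on q (arrive (a ∷ L) cs) n →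
              on q (moveInfinite ␣ right (tape L a cs)) n
    advance L a cs = subst (λ t → on _ t _) (sym (arrive-right L a cs))

    shift : ∀ (L cs : List Cell) → length L + suc (suc (length cs)) ≤ W →
            suc (length L) + suc (length cs) ≤ W
    shift L cs = subst (_≤ W) (ℕ.+-suc (length L) (suc (length cs)))

    unshift : ∀ (L cs : List Cell) → suc (length L) + suc (length cs) ≤ W →
              length L + suc (suc (length cs)) ≤ W
    unshift L cs = subst (_≤ W) (sym (ℕ.+-suc (length L) (suc (length cs))))

    shrink : ∀ (L cs : List Cell) → length L + suc (suc (length cs)) ≤ W →
             length L + suc (length cs) ≤ W
    shrink L cs = ℕ.≤-trans (ℕ.+-monoʳ-≤ (length L) (ℕ.n≤1+n _))

    -- The way home, from just after turning around on the cell c.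
    rewind-home : ∀ {l n} bs {c cs} → Fits W (tape (prefix bs) c cs) →
      on (run , l) (home (List.map just bs ʳ++ c ∷ cs)) n →
      on (rewind i , l) (moveInfinite ␣ left (tape (prefix bs) c cs)) n
    rewind-home {l} [] fit next = touch-step (return i l) (λ _ → refl) refl fit next
    rewind-home {l} (b ∷ bs) {c} {cs} fit next =
      touch-step (return i l) (λ _ → refl) refl fit′ (rewind-home bs fit′ next)
      where fit′ = unshift (prefix bs) cs fit

    module _ {l l′} (at : instruction l (scanned inp) ≡ inc i l′) where
      private
        rule : ∀ s → δ (sweep , l) (scanned inp) s ≡ carry l i l′ (lookup s i) s
        rule s = cong (λ I → sweepOver l I s) at

      -- The bound allows for one cell beyond cs, onto which the head may run.
      carry-sweep : ∀ {n} bs cs → Fits W (tape (prefix bs) ␣ cs) →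
        on (run , l′) (home (List.map just bs ʳ++ increment cs)) n →
        on (sweep , l) (arrive (prefix bs) cs) n
      carry-sweep bs [] fit next =
        touch-step (carry l i l′) rule refl fit (rewind-home bs fit next)
      carry-sweep bs (𝟙 ∷ cs) fit next =
        touch-step (carry l i l′) rule refl (shrink (prefix bs) cs fit)
          (advance (prefix bs) 𝟘 cs (carry-sweep (false ∷ bs) cs (shift (prefix bs) cs fit) next))
      carry-sweep bs (𝟘 ∷ cs) fit next =
        touch-step (carry l i l′) rule refl fit′ (rewind-home bs fit′ next)
        where fit′ = shrink (prefix bs) cs fit
      carry-sweep bs (␣ ∷ cs) fit next =
        touch-step (carry l i l′) rule refl fit′ (rewind-home bs fit′ next)
        where fit′ = shrink (prefix bs) cs fit

    module _ {l l′} (at : instruction l (scanned inp) ≡ dec i l′) where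
      private
        rule : ∀ s → δ (sweep , l) (scanned inp) s ≡ borrow l i l′ (lookup s i) s
        rule s = cong (λ I → sweepOver l I s) at

      borrow-sweep : ∀ {n} bs cs → isZero cs ≡ false → Fits W (tape (prefix bs) ␣ cs) →
        on (run , l′) (home (List.map just bs ʳ++ decrement cs)) n →
        on (sweep , l) (arrive (prefix bs) cs) n
      borrow-sweep bs (𝟘 ∷ cs) pos fit next =
        touch-step (borrow l i l′) rule refl (shrink (prefix bs) cs fit)
          (advance (prefix bs) 𝟙 cs (borrow-sweep (true ∷ bs) cs pos (shift (prefix bs) cs fit) next))
      borrow-sweep bs (𝟙 ∷ cs) pos fit next =
        touch-step (borrow l i l′) rule refl fit′ (rewind-home bs fit′ next)
        where fit′ = shrink (prefix bs) cs fit

    module _ {l l₀ l₁} (at : instruction l (scanned inp) ≡ test i l₀ l₁) where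
      private
        rule : ∀ s → δ (sweep , l) (scanned inp) s ≡ scan l i l₀ l₁ (lookup s i) s
        rule s = cong (λ I → sweepOver l I s) at

      scan-sweep : ∀ {n} bs cs → Fits W (tape (prefix bs) ␣ cs) →
        on (run , (if isZero cs then l₀ else l₁)) (home (List.map just bs ʳ++ visit cs)) n →
        on (sweep , l) (arrive (prefix bs) cs) n
      scan-sweep bs [] fit next =
        touch-step (scan l i l₀ l₁) rule refl fit (rewind-home bs fit next)
      scan-sweep bs (𝟘 ∷ cs) fit next =
        touch-step (scan l i l₀ l₁) rule refl (shrink (prefix bs) cs fit)
          (advance (prefix bs) 𝟘 cs (scan-sweep (false ∷ bs) cs (shift (prefix bs) cs fit) next))
      scan-sweep bs (𝟙 ∷ cs) fit next =
        touch-step (scan l i l₀ l₁) rule refl fit′ (rewind-home bs fit′ next)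
        where fit′ = shrink (prefix bs) cs fit
      scan-sweep bs (␣ ∷ cs) fit next =
        touch-step (scan l i l₀ l₁) rule refl fit′ (rewind-home bs fit′ next)
        where fit′ = shrink (prefix bs) cs fit

  module _ (K : ℕ) where

    private
      -- Room on each tape for the home cell, K digits, a blank left by a zero
      -- test, and the cell that the bounds during a sweep allow in addition.
      W : ℕ
      W = 3 + K

    -- All work heads are at home, and counter i has the cells `lookup css i`.
    Simulated : State → Tape InputSymbol → Vec (List Cell) d → ℕ → Set
    Simulated q inp css = Tree machine (d * W) (config q inp (Vec.map home css))

    stores-update : ∀ {e} {css : Vec (List Cell) e} {vs : Vec ℕ e} {cs v} →
      Pointwise (Stores K) css vs → Stores K cs v →
      ∀ i → Pointwise (Stores K) (css [ i ]≔ cs) (vs [ i ]≔ v)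
    stores-update (_ ∷ ss) s Fin.zero    = s ∷ ss
    stores-update (t ∷ ss) s (Fin.suc i) = t ∷ stores-update ss s i

    fits : ∀ {e} {css : Vec (List Cell) e} {vs : Vec ℕ e} → Pointwise (Stores K) css vs →
           All (Fits W) (Vec.map home css)
    fits []             = []
    fits ((s , _) ∷ ss) = ℕ.m≤n⇒m≤1+n (s≤s (shape⇒length s)) ∷ fits ss

    module _ {css : Vec (List Cell) d} {vs : Vec ℕ d}
             (ss : Pointwise (Stores K) css vs) where

      space-bound : Vec.sum (Vec.map visitedCells (Vec.map home css)) ≤ d * W
      space-bound = fits⇒space (fits ss)

      untouched : ∀ {q inp n} → Simulated q inp css n →
        let ts = Vec.map home css in
        Tree machine (d * W) (config q inp (act (Vec.map keep (Vec.map scanned ts)) ts)) n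
      untouched = subst (λ ts → Tree machine (d * W) (config _ _ ts) _)
        (sym (act-keep (Vec.map home css)))

      -- An operation on counter i first moves head i off its home cell; the
      -- remaining steps may assume that the sweep stays within the space bound.
      sweep-begin : ∀ {l n inp} i →
        (∀ s → execute l (instruction l (scanned inp)) s ≡ touch i (sweep , l) ␣ right s) →
        (Fits W (tape [ ␣ ] ␣ (lookup css i)) →
          Sweep.on inp (fits ss) i (sweep , l) (arrive [ ␣ ] (lookup css i)) n) →
        Simulated (run , l) inp css n
      sweep-begin {l} {n} {inp} i at next = subst
        (λ ts → Tree machine (d * W) (config _ inp ts) n)
        (trans (cong (Vec.map home css [ i ]≔_) (sym (lookup-map i home css)))
               ([]≔-lookup (Vec.map home css) i))
        (touch-step {t = home cells} (λ _ → touch i (sweep , l) ␣ right) at refl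
          (ℕ.≤-trans (ℕ.n≤1+n _) fit) (advance [] ␣ cells (next fit)))
        where
        open Sweep inp (fits ss) i
        cells = lookup css i
        fit : Fits W (tape [ ␣ ] ␣ cells)
        fit = s≤s (s≤s (shape⇒length (proj₁ (Pointwise.lookup ss i))))

      sweep-end : ∀ {q inp cs n} i → Simulated q inp (css [ i ]≔ cs) n →
                  Sweep.on inp (fits ss) i q (home cs) n
      sweep-end {q} {inp} {cs} {n} i =
        subst (λ ts → Tree machine (d * W) (config q inp ts) n) (map-[]≔ home css i)

    -- A run of the program is carried out by the machine, with the same number
    -- of accepting paths.
    simulate : ∀ {l inp vs css n} → Run P K l inp vs n → Pointwise (Stores K) css vs →
               Simulated (run , l) inp css n
    simulate {l} {inp} {vs} {css} r ss = go r
      where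
      at : ∀ {I} → instruction l (scanned inp) ≡ I → ∀ s →
           execute l (instruction l (scanned inp)) s ≡ execute l I s
      at eq s = cong (λ I → execute l I s) eq

      stored : ∀ {i v} → lookup vs i ≡ v → Stores K (lookup css i) v
      stored {i} v≡ = subst (Stores K (lookup css i)) v≡ (Pointwise.lookup ss i)

      replace : ∀ {i l′ cs v n} → Stores K cs v → Run P K l′ inp (vs [ i ]≔ v) n →
                Sweep.on inp (fits ss) i (run , l′) (home cs) n
      replace {i} st r = sweep-end ss i (simulate r (stores-update ss st i))

      branch : ∀ {i l₀ l₁ n z} → instruction l (scanned inp) ≡ test i l₀ l₁ →
               isZero (lookup css i) ≡ z → Run P K (if z then l₀ else l₁) inp vs n →
               Simulated (run , l) inp css n
      branch {i} {n = n} eq refl r = sweep-begin ss i (at eq) λ fit →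
        Sweep.scan-sweep inp (fits ss) i eq [] (lookup css i) fit
          (sweep-end ss i (simulate r (subst (Pointwise (Stores K) _) ([]≔-lookup vs i)
            (stores-update ss (visit-stores (stored refl)) i))))

      go : ∀ {n} → Run P K l inp vs n → Simulated (run , l) inp css n
      go (accept eq yes!)      = accept (at eq _) yes! (space-bound ss)
      go (reject eq no!)       = reject (at eq _) no! (space-bound ss)
      go (move eq r)           = step (at eq _) (space-bound ss) (untouched ss (simulate r ss))
      go (fork eq r₁ r₂)       = fork (at eq _) (space-bound ss)
                                   (untouched ss (simulate r₁ ss)) (untouched ss (simulate r₂ ss))
      go (inc {i} eq v≡ bnd r) = sweep-begin ss i (at eq) λ fit →
        Sweep.carry-sweep inp (fits ss) i eq [] (lookup css i) fit
          (replace (increment-stores (stored v≡) bnd) r)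
      go (dec {i} eq v≡ r)     = sweep-begin ss i (at eq) λ fit →
        Sweep.borrow-sweep inp (fits ss) i eq [] (lookup css i) (isZero-stores-suc (stored v≡)) fit
          (replace (decrement-stores (stored v≡)) r)
      go (ifZero eq v≡ r)      = branch eq (isZero-stores-zero (stored v≡)) r
      go (ifNonzero eq v≡ r)   = branch eq (isZero-stores-suc (stored v≡)) r

-- Counter programs compute functions in #L

initialTape : Word → Tape InputSymbol
initialTape x = tape [] leftEnd (List.map letter x ++ [ rightEnd ])

-- A number of binary digits that suffices for the length of x.
width : Word → ℕ
width x = suc ⌊log₂ length x ⌋

length<2^width : ∀ x → length x < 2 ^ width x
length<2^width x = ℕ.≰⇒> λ 2^w≤n → ℕ.<-irrefl refl
  (subst (_≤ ⌊log₂ length x ⌋) (⌊log₂[2^n]⌋≡n (width x)) (⌊log₂⌋-mono-≤ 2^w≤n))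

module _ (P : Program) (f : Word → ℕ)
         (runs : ∀ x → Run P (width x) (Program.start P) (initialTape x)
                           (Vec.replicate (Program.counters P) 0) (f x)) where
  open Program P
  open Compilation P

  private
    trees : ∀ x → Tree machine (counters * (3 + width x)) (initial machine x) (f x)
    trees x = subst
      (λ ts → Tree machine (counters * (3 + width x)) (config (run , start) (initialTape x) ts) (f x))
      (map-replicate home [] counters)
      (simulate (width x) (runs x) (blank-stores counters))
      where
      blank-stores : ∀ d → Pointwise (Stores (width x)) (Vec.replicate d []) (Vec.replicate d 0)
      blank-stores zero    = []
      blank-stores (suc d) = ([] , refl) ∷ blank-stores d

    linear : ∀ m → 1 ≤ m → 4 + m ≤ 5 * m
    linear m 1≤m = subst (_≤ 5 * m) (ℕ.+-comm m 4) (ℕ.+-monoʳ-≤ m (ℕ.*-monoʳ-≤ 4 1≤m))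

    -- From length 2 on, the logarithm is positive and absorbs the constant.
    logSpace : UsesLogSpace machine
    logSpace = counters * 5 , 2 , λ x 2≤n c reach →
      ℕ.≤-trans (tree⇒space (trees x) reach) (subst (counters * (3 + width x) ≤_)
        (sym (ℕ.*-assoc counters 5 ⌊log₂ length x ⌋))
        (ℕ.*-monoʳ-≤ counters (linear _
          (subst (_≤ ⌊log₂ length x ⌋) (⌊log₂[2^n]⌋≡n 1) (⌊log₂⌋-mono-≤ 2≤n)))))

  computes⇒∈#L : f ∈#L
  computes⇒∈#L = machine , logSpace , (λ x → tree⇒acc (trees x)) , (λ x → tree⇒paths (trees x))

-- A counter program for the Entringer numbers

-- The labels of the last five patterns carry a counter s, called own; the
-- two counters exchange their roles during a run.
--
-- From `base`, the program counts the ones before the 0 in counter 1; from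
-- `index`, each further one moves a unit from counter 1 to counter 0.  From
-- `unary`, it counts the ones of an input without 0 in counter 0.
--
-- At `main s`, let a be the value of counter s and b that of the other one.
-- If a = 0, then the program accepts iff b = 0.  Otherwise a is decremented,
-- and either b is incremented or the counters exchange their roles.
Label : Set
Label = Fin 10 ⊎ Fin 5 × Fin 2

pattern base      = inj₁ 0F
pattern baseNext  = inj₁ 1F
pattern index     = inj₁ 2F
pattern indexDec  = inj₁ 3F
pattern indexInc  = inj₁ 4F
pattern indexNext = inj₁ 5F
pattern unary     = inj₁ 6F
pattern unaryNext = inj₁ 7F
pattern accepted  = inj₁ 8F
pattern rejected  = inj₁ 9F
pattern main s    = inj₂ (0F , s)
pattern pick s    = inj₂ (1F , s)
pattern choose s  = inj₂ (2F , s)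
pattern grow s    = inj₂ (3F , s)
pattern last s    = inj₂ (4F , s)

other : Fin 2 → Fin 2
other 0F = 1F
other 1F = 0F

instructions : Label → InputSymbol → Instruction Label 2
instructions base leftEnd            = move right base
instructions base (letter true)      = inc 1F baseNext
instructions base (letter false)     = move right index
instructions base rightEnd           = move stay rejected
instructions baseNext _              = move right base
instructions index (letter true)     = test 1F rejected indexDec
instructions index rightEnd          = move stay (main 0F)
instructions index _                 = move stay rejected
instructions indexDec _              = dec 1F indexInc
instructions indexInc _              = inc 0F indexNext
instructions indexNext _             = move right index
instructions unary leftEnd           = move right unary
instructions unary (letter true)     = inc 0F unaryNext
instructions unary (letter false)    = move stay rejected
instructions unary rightEnd          = move stay (main 0F)
instructions unaryNext _             = move right unary
instructions (main s) _              = test s (last s) (pick s)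
instructions (pick s) _              = dec s (choose s)
instructions (choose s) _            = fork (grow s) (main (other s)) λ ()
instructions (grow s) _              = inc (other s) (main s)
instructions (last s) _              = test (other s) accepted rejected
instructions accepted _              = halt
instructions rejected _              = halt

acceptsAt : Label → Bool
acceptsAt accepted = true
acceptsAt _        = false

program : Label → Program
program l = record
  { Label        = Label
  ; label-finite = _ , ↔-trans (↔-refl ⊎-↔ ↔-sym Fin.*↔×) (↔-sym Fin.+↔⊎)
  ; counters     = 2
  ; start        = l
  ; accepting    = acceptsAt
  ; instruction  = instructions
  }

-- Counter s holds a and the other counter holds b.
store : Fin 2 → ℕ → ℕ → Vec ℕ 2
store 0F a b = a ∷ b ∷ []
store 1F a b = b ∷ a ∷ []

lookup-own : ∀ s {a b} → lookup (store s a b) s ≡ a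
lookup-own 0F = refl
lookup-own 1F = refl

lookup-other : ∀ s {a b} → lookup (store s a b) (other s) ≡ b
lookup-other 0F = refl
lookup-other 1F = refl

set-own : ∀ s {a b c} → store s a b [ s ]≔ c ≡ store s c b
set-own 0F = refl
set-own 1F = refl

set-other : ∀ s {a b c} → store s a b [ other s ]≔ c ≡ store s a c
set-other 0F = refl
set-other 1F = refl

store-other : ∀ s {a b} → store (other s) a b ≡ store s b a
store-other 0F = refl
store-other 1F = refl

-- The number of accepting paths from `unary` with n in counter 0, as a
-- function of the rest of the input; likewise from `index` with a and b in
-- counters 0 and 1, and from `base` with n in counter 1.
afterUnary : ℕ → Word → ℕ
afterUnary n []          = entringer n n
afterUnary n (true ∷ x)  = afterUnary (suc n) x
afterUnary n (false ∷ x) = 0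

afterIndex : ℕ → ℕ → Word → ℕ
afterIndex a b       []          = entringer (a + b) a
afterIndex a zero    (true ∷ x)  = 0
afterIndex a (suc b) (true ∷ x)  = afterIndex (suc a) b x
afterIndex a b       (false ∷ x) = 0

afterBase : ℕ → Word → ℕ
afterBase n []          = 0
afterBase n (true ∷ x)  = afterBase (suc n) x
afterBase n (false ∷ x) = afterIndex 0 n x

module _ {l₀ : Label} {K : ℕ} where

  Runs : Label → Tape InputSymbol → Vec ℕ 2 → ℕ → Set
  Runs = Run (program l₀) K

  recast : ∀ {l inp vs ws n} → vs ≡ ws → Runs l inp vs n → Runs l inp ws n
  recast refl r = r

  -- With n = a + b, the two choices lead to E(n, a - 1) and E(n - 1, b), which
  -- are the two terms of the recurrence.  The sum a + b never grows, which
  -- bounds the counters; it decreases when the counters exchange roles, and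
  -- otherwise a decreases.
  main-run : ∀ n s a b {inp} → a + b ≡ n → n < 2 ^ K →
             Runs (main s) inp (store s a b) (entringer n a)
  main-run zero s zero zero _ _ =
    ifZero refl (lookup-own s) (ifZero refl (lookup-other s) (accept refl refl))
  main-run (suc n) s zero (suc b) {inp} refl _ =
    ifZero refl (lookup-own s) (ifNonzero refl (lookup-other s)
      (subst (Runs rejected inp _) (sym (entringer-zero n)) (reject refl refl)))
  main-run (suc n) s (suc a) b {inp} refl n< =
    ifNonzero refl (lookup-own s) (dec refl (lookup-own s) (recast (sym (set-own s))
      (subst (Runs (choose s) inp _) (sym count) (fork refl
        (inc refl (lookup-other s) (ℕ.≤-<-trans (s≤s (ℕ.m≤n+m b a)) n<) (recast (sym (set-other s))
          (main-run (suc (a + b)) s a (suc b) (ℕ.+-suc a b) n<)))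
        (recast (store-other s)
          (main-run (a + b) (other s) b a (ℕ.+-comm b a) (ℕ.<-trans (ℕ.n<1+n _) n<)))))))
    where
    count : entringer (suc (a + b)) (suc a) ≡ entringer (suc (a + b)) a + entringer (a + b) b
    count = trans (entringer-suc (ℕ.m≤m+n a b))
      (cong (λ c → entringer (suc (a + b)) a + entringer (a + b) c) (ℕ.m+n∸m≡n a b))

  -- The input head is at the first letter of the given rest of the input.
  cursor : List InputSymbol → Word → Tape InputSymbol
  cursor bs []      = tape bs rightEnd []
  cursor bs (b ∷ x) = tape bs (letter b) (List.map letter x ++ [ rightEnd ])

  right-cursor : ∀ {bs a} x →
    moveBounded right (tape bs a (List.map letter x ++ [ rightEnd ])) ≡ cursor (a ∷ bs) x
  right-cursor []      = refl
  right-cursor (_ ∷ _) = refl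

  read : ∀ {l l′ bs a x vs n} → instructions l a ≡ move right l′ →
         Runs l′ (cursor (a ∷ bs) x) vs n →
         Runs l (tape bs a (List.map letter x ++ [ rightEnd ])) vs n
  read {x = x} {vs} {n} eq r = move eq (subst (λ inp → Runs _ inp vs n) (sym (right-cursor x)) r)

  fail : ∀ {l inp vs} → instructions l (scanned inp) ≡ move stay rejected → Runs l inp vs 0
  fail eq = move eq (reject refl refl)

  unary-run : ∀ {bs} n x → n + length x < 2 ^ K →
              Runs unary (cursor bs x) (n ∷ 0 ∷ []) (afterUnary n x)
  unary-run n [] bound = move refl
    (main-run n 0F n 0 (ℕ.+-identityʳ n) (subst (_< 2 ^ K) (ℕ.+-identityʳ n) bound))
  unary-run n (true ∷ x) bound = inc refl refl (ℕ.≤-<-trans (ℕ.m≤m+n (suc n) (length x)) bound′)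
    (read refl (unary-run (suc n) x bound′))
    where bound′ = subst (_< 2 ^ K) (ℕ.+-suc n (length x)) bound
  unary-run n (false ∷ x) bound = fail refl

  index-run : ∀ {bs} a b x → a + b < 2 ^ K →
              Runs index (cursor bs x) (a ∷ b ∷ []) (afterIndex a b x)
  index-run a b       []          bound = move refl (main-run (a + b) 0F a b refl bound)
  index-run a zero    (true ∷ x)  bound = ifZero refl refl (reject refl refl)
  index-run a (suc b) (true ∷ x)  bound = ifNonzero refl refl (dec refl refl
    (inc refl refl (ℕ.≤-<-trans (ℕ.m≤m+n (suc a) b) bound′) (read refl (index-run (suc a) b x bound′))))
    where bound′ = subst (_< 2 ^ K) (ℕ.+-suc a b) bound
  index-run a zero    (false ∷ x) bound = fail refl
  index-run a (suc b) (false ∷ x) bound = fail refl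

  base-run : ∀ {bs} n x → n + length x < 2 ^ K →
             Runs base (cursor bs x) (0 ∷ n ∷ []) (afterBase n x)
  base-run n []          bound = fail refl
  base-run n (true ∷ x)  bound = inc refl refl (ℕ.≤-<-trans (ℕ.m≤m+n (suc n) (length x)) bound′)
    (read refl (base-run (suc n) x bound′))
    where bound′ = subst (_< 2 ^ K) (ℕ.+-suc n (length x)) bound
  base-run n (false ∷ x) bound = read refl (index-run 0 n x (ℕ.≤-<-trans (ℕ.m≤m+n n _) bound))

-- The computed functions

extendByZero-unique : {enc : A → Word} (code? : ∀ x → Dec (∃ λ a → x ≡ enc a)) →
  ∀ {g v} x → (∀ a → x ≡ enc a → v ≡ g a) → (¬ (∃ λ a → x ≡ enc a) → v ≡ 0) →
  v ≡ extendByZero enc code? g x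
extendByZero-unique code? x inside outside with code? x
... | yes (a , eq) = inside a eq
... | no ¬enc      = outside ¬enc

afterUnary-1^ : ∀ m n → afterUnary m (1^ n) ≡ entringer (m + n) (m + n)
afterUnary-1^ m zero    = sym (cong₂ entringer (ℕ.+-identityʳ m) (ℕ.+-identityʳ m))
afterUnary-1^ m (suc n) = trans (afterUnary-1^ (suc m) n)
  (sym (cong₂ entringer (ℕ.+-suc m n) (ℕ.+-suc m n)))

afterUnary-other : ∀ m x → ¬ (∃ λ n → x ≡ 1^ n) → afterUnary m x ≡ 0
afterUnary-other m []          ¬1ⁿ = contradiction (0 , refl) ¬1ⁿ
afterUnary-other m (true ∷ x)  ¬1ⁿ =
  afterUnary-other (suc m) x λ where (n , refl) → ¬1ⁿ (suc n , refl)
afterUnary-other m (false ∷ x) ¬1ⁿ = refl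

afterIndex-1^ : ∀ a b k → afterIndex a b (1^ k) ≡ entringer (a + b) (a + k)
afterIndex-1^ a b       zero    = cong (entringer (a + b)) (sym (ℕ.+-identityʳ a))
-- Here the index exceeds the base, and both sides vanish.
afterIndex-1^ a zero    (suc k) =
  sym (entringer-out-of-range (ℕ.+-monoʳ-< a (s≤s z≤n)))
afterIndex-1^ a (suc b) (suc k) = trans (afterIndex-1^ (suc a) b k)
  (sym (cong₂ entringer (ℕ.+-suc a b) (ℕ.+-suc a k)))

afterIndex-other : ∀ a b x → ¬ (∃ λ k → x ≡ 1^ k) → afterIndex a b x ≡ 0
afterIndex-other a b       []          ¬1ᵏ = contradiction (0 , refl) ¬1ᵏ
afterIndex-other a zero    (true ∷ x)  ¬1ᵏ = refl
afterIndex-other a (suc b) (true ∷ x)  ¬1ᵏ =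
  afterIndex-other (suc a) b x λ where (k , refl) → ¬1ᵏ (suc k , refl)
afterIndex-other a zero    (false ∷ x) ¬1ᵏ = refl
afterIndex-other a (suc b) (false ∷ x) ¬1ᵏ = refl

afterBase-1^01^ : ∀ m n k → afterBase m (1^ n 01^ k) ≡ entringer (m + n) k
afterBase-1^01^ m zero    k = trans (afterIndex-1^ 0 m k)
  (cong (λ n → entringer n k) (sym (ℕ.+-identityʳ m)))
afterBase-1^01^ m (suc n) k = trans (afterBase-1^01^ (suc m) n k)
  (cong (λ n → entringer n k) (sym (ℕ.+-suc m n)))

afterBase-other : ∀ m x → ¬ (∃ λ ((n , k) : ℕ × ℕ) → x ≡ 1^ n 01^ k) → afterBase m x ≡ 0
afterBase-other m []          ¬1ⁿ01ᵏ = refl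
afterBase-other m (true ∷ x)  ¬1ⁿ01ᵏ =
  afterBase-other (suc m) x λ where ((n , k) , refl) → ¬1ⁿ01ᵏ ((suc n , k) , refl)
afterBase-other m (false ∷ x) ¬1ⁿ01ᵏ =
  afterIndex-other 0 m x λ where (k , refl) → ¬1ⁿ01ᵏ ((0 , k) , refl)

afterBase≡entringerFunction : ∀ x → afterBase 0 x ≡ entringerFunction x
afterBase≡entringerFunction x = extendByZero-unique unaryPair? x
  (λ where (n , k) refl → afterBase-1^01^ 0 n k)
  (afterBase-other 0 x)

afterUnary≡eulerFunction : ∀ x → afterUnary 0 x ≡ eulerFunction x
afterUnary≡eulerFunction x = extendByZero-unique unary? x
  (λ where n refl → trans (afterUnary-1^ 0 n) (sym (euler≡entringer n)))
  (afterUnary-other 0 x)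

theorem3p26 : (entringerFunction ∈#L) × ((n : ℕ) → euler n ≡ entringer n n) × (eulerFunction ∈#L)
theorem3p26 =
  computes⇒∈#L (program base) entringerFunction (λ x →
    subst (Run (program base) (width x) base (initialTape x) _) (afterBase≡entringerFunction x)
      (read refl (base-run 0 x (length<2^width x)))) ,
  euler≡entringer ,
  computes⇒∈#L (program unary) eulerFunction (λ x →
    subst (Run (program unary) (width x) unary (initialTape x) _) (afterUnary≡eulerFunction x)
      (read refl (unary-run 0 x (length<2^width x))))
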